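{- Let $A$ be a commutative ring, $k\ge1$, $\vec s=(n_1,\dots,n_k)$ a tuple of positive integers, $X_\bullet=X_\bullet(\vec s;A)$ the diagonal simplicial tensor module with boundary $\partial$, and $\mathcal F^\bullet$ the shifted depth filtration. The spectral sequence of the filtered complex $(X_\bullet,\partial,\mathcal F^\bullet)$ satisfies $$E_1^{t,q}=0\qquad\text{for all }t,q.$$ Hence it collapses at the $E_1$-page.
   Context: Notation: $[p]=\{0,\dots,p\}$. For a shape $\vec s=(n_1,\dots,n_k)$ put $n=\min(n_1,\dots,n_k)-1$, $M_a(p)=n_a-1-n+p$ (so $M_a(p)\ge p$) and $I_p=\prod_{a=1}^k[M_a(p)]$ for $p\ge 0$. Let $\delta_i^q:[q-1]\to[q]$ be the increasing injection missing $i$, and $\Delta_i^p=\prod_{a=1}^k\delta_i^{M_a(p)}:I_{p-1}\to I_p$ ($p\ge1$, $0\le i\le p$). The diagonal simplicial tensor module has $X_p=A^{I_p}$ (all functions $T:I_p\to A$) and faces $d_i^p(T)=T\circ\Delta_i^p$; the boundary of the associated unaugmented chain complex is $\partial_p=\sum_{i=0}^p(-1)^id_i^p$ for $p\ge1$, with $\partial_0=0$ and $X_p=0$ for $p<0$. The shifted depth filtration is the decreasing filtration by subcomplexes, for $p\ge0$ and $t\in\mathbb Z$, $\mathcal F^tX_p=\{T\in X_p: T(m)=0\text{ unless }\min_a m_a\ge t+p\}$. In the associated spectral sequence, $E_0$ is the associated graded complex $\bigoplus_t\mathcal F^tX_\bullet/\mathcal F^{t+1}X_\bullet$ with differential $d^0$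 induced by $\partial$, and $E_1$ is the homology of $(E_0,d^0)$; the terms $E_1^{t,q}$ (with $q$ the complementary index) are the homology modules of the complex $\mathcal F^tX_\bullet/\mathcal F^{t+1}X_\bullet$ in the various degrees. -}

module Defs where

open import Level using (Level; _⊔_) renaming (suc to lsuc)
open import Algebra.Bundles using (CommutativeMonoid; CommutativeRing; Ring)
open import Algebra.Module.Bundles using (LeftModule)
open import Algebra.Module.Morphism.Structures using (module LeftModuleMorphisms)
import Algebra.Construct.Pointwise as Pointwise
import Algebra.Module.Construct.Zero as Zero
import Algebra.Properties.AbelianGroup as AbelianGroupProperties
import Algebra.Properties.CommutativeSemigroup as CommutativeSemigroupProperties
import Algebra.Properties.Ring as RingProperties
import Algebra.Properties.Semiring.Exp as Exp
import Algebra.Properties.Semiring.Sum as Sum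
open import Data.Fin.Base using (Fin; zero; suc; toℕ; punchIn; inject₁; _↑ˡ_)
open import Data.Integer.Base as Int using (ℤ; +_; -[1+_]; 0ℤ; 1ℤ) renaming (suc to sucℤ; pred to predℤ)
import Data.Integer.Properties as ℤₚ
open import Data.Nat.Base as ℕ using (ℕ; zero; suc; _∸_; _⊓_)
import Data.Nat.Properties as ℕₚ
open import Data.Product.Base using (Σ; ∃; _×_; _,_; proj₁; proj₂)
open import Data.Unit.Polymorphic.Base using (⊤; tt)
open import Data.Vec.Base using (Vec; []; _∷_; foldr₁)
open import Data.Vec.Relation.Unary.All as All using (All; []; _∷_)
open import Function.Base using (_∘_)
open import Relation.Binary.PropositionalEquality.Core as ≡ using (_≡_)
open import Relation.Nullary.Negation.Core using (¬_)
import Relation.Binary.Reasoning.Setoid as SetoidReasoning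

module Modules {r ℓr : Level} (R : Ring r ℓr) where

  private
    module R = Ring R

  module ModuleProperties {m ℓm : Level} (M : LeftModule R m ℓm) where
    open LeftModule M
    open AbelianGroupProperties +ᴹ-abelianGroup public
      using () renaming
        ( inverseʳ-unique to -ᴹ-unique; ⁻¹-involutive to -ᴹ-involutive
        ; ⁻¹-∙-comm to -ᴹ-+ᴹ-comm; ε⁻¹≈ε to -ᴹ0≈0; x≈y⇒x∙y⁻¹≈ε to ≈⇒-≈0
        ; x∙y⁻¹≈ε⇒x≈y to -≈0⇒≈; ⁻¹-anti-homo‿- to -ᴹ-anti )
    open CommutativeSemigroupProperties
      (CommutativeMonoid.commutativeSemigroup +ᴹ-commutativeMonoid)
      public using (interchange)
    open SetoidReasoning ≈ᴹ-setoid

    infixl 6 _-ᴹ_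
    _-ᴹ_ : Carrierᴹ → Carrierᴹ → Carrierᴹ
    x -ᴹ y = x +ᴹ (-ᴹ y)

    -ᴹ-cong₂ : ∀ {x y u v} → x ≈ᴹ y → u ≈ᴹ v → x -ᴹ u ≈ᴹ y -ᴹ v
    -ᴹ-cong₂ p q = +ᴹ-cong p (-ᴹ‿cong q)

    -ᴹ-interchange : ∀ x y u v → (x +ᴹ y) -ᴹ (u +ᴹ v) ≈ᴹ (x -ᴹ u) +ᴹ (y -ᴹ v)
    -ᴹ-interchange x y u v =
      ≈ᴹ-trans (+ᴹ-congˡ (≈ᴹ-sym (-ᴹ-+ᴹ-comm u v))) (interchange x y _ _)

    -ᴹ-telescope : ∀ x y z → (x -ᴹ y) +ᴹ (y -ᴹ z) ≈ᴹ x -ᴹ z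
    -ᴹ-telescope x y z = begin
      (x -ᴹ y) +ᴹ (y -ᴹ z)          ≈⟨ +ᴹ-assoc x _ _ ⟩
      x +ᴹ ((-ᴹ y) +ᴹ (y -ᴹ z))     ≈⟨ +ᴹ-congˡ (≈ᴹ-sym (+ᴹ-assoc _ y _)) ⟩
      x +ᴹ (((-ᴹ y) +ᴹ y) -ᴹ z)     ≈⟨ +ᴹ-congˡ (+ᴹ-congʳ (-ᴹ‿inverseˡ y)) ⟩
      x +ᴹ (0ᴹ -ᴹ z)                ≈⟨ +ᴹ-congˡ (+ᴹ-identityˡ _) ⟩
      x -ᴹ z                        ∎

    x-0≈x : ∀ x → x -ᴹ 0ᴹ ≈ᴹ x
    x-0≈x x = ≈ᴹ-trans (+ᴹ-congˡ -ᴹ0≈0) (+ᴹ-identityʳ x)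

    *ₗ-neg : ∀ a x → a *ₗ (-ᴹ x) ≈ᴹ -ᴹ (a *ₗ x)
    *ₗ-neg a x = -ᴹ-unique _ _ (begin
      (a *ₗ x) +ᴹ (a *ₗ (-ᴹ x))   ≈⟨ *ₗ-distribˡ a x _ ⟨
      a *ₗ (x -ᴹ x)               ≈⟨ *ₗ-congˡ (-ᴹ‿inverseʳ x) ⟩
      a *ₗ 0ᴹ                     ≈⟨ *ₗ-zeroʳ a ⟩
      0ᴹ                          ∎)

    -1*ₗ : ∀ x → (R.- R.1#) *ₗ x ≈ᴹ -ᴹ x
    -1*ₗ x = -ᴹ-unique _ _ (begin
      x +ᴹ ((R.- R.1#) *ₗ x)              ≈⟨ +ᴹ-congʳ (*ₗ-identityˡ x) ⟨
      (R.1# *ₗ x) +ᴹ ((R.- R.1#) *ₗ x)    ≈⟨ *ₗ-distribʳ x _ _ ⟨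
      (R.1# R.+ (R.- R.1#)) *ₗ x          ≈⟨ *ₗ-congʳ (R.-‿inverseʳ R.1#) ⟩
      R.0# *ₗ x                           ≈⟨ *ₗ-zeroˡ x ⟩
      0ᴹ                                  ∎)

  IsZero : ∀ {m ℓm : Level} → LeftModule R m ℓm → Set (m ⊔ ℓm)
  IsZero M = ∀ x → x ≈ᴹ 0ᴹ
    where
    open LeftModule M

  record Hom {m ℓm n ℓn : Level} (M : LeftModule R m ℓm) (N : LeftModule R n ℓn)
             : Set (r ⊔ m ⊔ ℓm ⊔ n ⊔ ℓn) where
    private
      module M = LeftModule M
      module N = LeftModule N
    open LeftModuleMorphisms M.rawLeftModule N.rawLeftModule
    field
      ⟦_⟧                      : M.Carrierᴹ → N.Carrierᴹ
      isLeftModuleHomomorphism : IsLeftModuleHomomorphism ⟦_⟧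
    open IsLeftModuleHomomorphism isLeftModuleHomomorphism public

    private
      module Nₚ = ModuleProperties N
      module Mₚ = ModuleProperties M

    sub-homo : ∀ x y → ⟦ x Mₚ.-ᴹ y ⟧ N.≈ᴹ ⟦ x ⟧ Nₚ.-ᴹ ⟦ y ⟧
    sub-homo x y = N.≈ᴹ-trans (+ᴹ-homo x _) (N.+ᴹ-congˡ (-ᴹ-homo y))

  module _ {m ℓm n ℓn : Level} {M : LeftModule R m ℓm} {N : LeftModule R n ℓn} where
    private
      module M = LeftModule M
      module N = LeftModule N
      module Mₚ = ModuleProperties M
      module Nₚ = ModuleProperties N

    mkHom : (f : M.Carrierᴹ → N.Carrierᴹ) →
            (∀ {x y} → x M.≈ᴹ y → f x N.≈ᴹ f y) →
            (∀ x y → f (x M.+ᴹ y) N.≈ᴹ f x N.+ᴹ f y) →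
            (∀ a x → f (a M.*ₗ x) N.≈ᴹ a N.*ₗ f x) →
            Hom M N
    mkHom f f-cong f-+ f-* = record
      { ⟦_⟧ = f
      ; isLeftModuleHomomorphism = record
        { +ᴹ-isGroupHomomorphism = record
          { isMonoidHomomorphism = record
            { isMagmaHomomorphism = record
              { isRelHomomorphism = record { cong = f-cong }
              ; homo              = f-+
              }
            ; ε-homo = N.≈ᴹ-trans (f-cong (M.≈ᴹ-sym (M.*ₗ-zeroˡ M.0ᴹ)))
                         (N.≈ᴹ-trans (f-* _ _) (N.*ₗ-zeroˡ _))
            }
          ; ⁻¹-homo = λ x → N.≈ᴹ-trans (f-cong (M.≈ᴹ-sym (Mₚ.-1*ₗ x)))
                              (N.≈ᴹ-trans (f-* _ _) (Nₚ.-1*ₗ _))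
          }
        ; *ₗ-homo = f-*
        }
      }

  IsZeroHom : ∀ {m ℓm n ℓn : Level} {M : LeftModule R m ℓm} {N : LeftModule R n ℓn} →
              Hom M N → Set (m ⊔ ℓn)
  IsZeroHom {N = N} f = ∀ x → Hom.⟦ f ⟧ x ≈ᴹ 0ᴹ
    where
    open LeftModule N

  _≅_ : ∀ {m ℓm n ℓn : Level} → LeftModule R m ℓm → LeftModule R n ℓn →
        Set (r ⊔ m ⊔ ℓm ⊔ n ⊔ ℓn)
  M ≅ N = ∃ IsLeftModuleIsomorphism
    where
    open LeftModuleMorphisms (LeftModule.rawLeftModule M) (LeftModule.rawLeftModule N)

  record Submodule {m ℓm : Level} (M : LeftModule R m ℓm) (s : Level)
                   : Set (r ⊔ m ⊔ ℓm ⊔ lsuc s) where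
    open LeftModule M
    open ModuleProperties M
    field
      Member    : Carrierᴹ → Set s
      resp      : ∀ {x y} → x ≈ᴹ y → Member x → Member y
      0-closed  : Member 0ᴹ
      +-closed  : ∀ {x y} → Member x → Member y → Member (x +ᴹ y)
      *ₗ-closed : ∀ a {x} → Member x → Member (a *ₗ x)

    neg-closed : ∀ {x} → Member x → Member (-ᴹ x)
    neg-closed x∈ = resp (-1*ₗ _) (*ₗ-closed _ x∈)

    ≈0⇒Member : ∀ {x} → x ≈ᴹ 0ᴹ → Member x
    ≈0⇒Member x≈0 = resp (≈ᴹ-sym x≈0) 0-closed

    ≈⇒Member : ∀ {x y} → x ≈ᴹ y → Member (x -ᴹ y)
    ≈⇒Member x≈y = ≈0⇒Member (≈⇒-≈0 x≈y)

  infix 4 _∈_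
  _∈_ : ∀ {m ℓm s : Level} {M : LeftModule R m ℓm} →
        LeftModule.Carrierᴹ M → Submodule M s → Set s
  x ∈ P = Submodule.Member P x

  zeroˢ : ∀ {m ℓm : Level} (M : LeftModule R m ℓm) → Submodule M ℓm
  zeroˢ M = record
    { Member    = _≈ᴹ 0ᴹ
    ; resp      = λ x≈y x≈0 → ≈ᴹ-trans (≈ᴹ-sym x≈y) x≈0
    ; 0-closed  = ≈ᴹ-refl
    ; +-closed  = λ p q → ≈ᴹ-trans (+ᴹ-cong p q) (+ᴹ-identityˡ 0ᴹ)
    ; *ₗ-closed = λ a p → ≈ᴹ-trans (*ₗ-congˡ p) (*ₗ-zeroʳ a)
    }
    where
    open LeftModule M

  fullˢ : ∀ {m ℓm s : Level} (M : LeftModule R m ℓm) → Submodule M s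
  fullˢ M = record { Member = λ _ → ⊤ }

  infixr 7 _∩_
  _∩_ : ∀ {m ℓm s s′ : Level} {M : LeftModule R m ℓm} →
        Submodule M s → Submodule M s′ → Submodule M (s ⊔ s′)
  P ∩ Q = record
    { Member    = λ x → x ∈ P × x ∈ Q
    ; resp      = λ e (p , q) → P.resp e p , Q.resp e q
    ; 0-closed  = P.0-closed , Q.0-closed
    ; +-closed  = λ (p , q) (p′ , q′) → P.+-closed p p′ , Q.+-closed q q′
    ; *ₗ-closed = λ a (p , q) → P.*ₗ-closed a p , Q.*ₗ-closed a q
    }
    where
    module P = Submodule P
    module Q = Submodule Q

  infixl 6 _⊕_
  -- The sum P + Q inside M; it need not be direct.
  _⊕_ : ∀ {m ℓm s s′ : Level} {M : LeftModule R m ℓm} →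
        Submodule M s → Submodule M s′ → Submodule M (m ⊔ ℓm ⊔ s ⊔ s′)
  _⊕_ {M = M} P Q = record
    { Member    = λ x → ∃ λ a → ∃ λ b → a ∈ P × b ∈ Q × x ≈ᴹ a +ᴹ b
    ; resp      = λ e (a , b , p , q , x≈) → a , b , p , q , ≈ᴹ-trans (≈ᴹ-sym e) x≈
    ; 0-closed  = 0ᴹ , 0ᴹ , P.0-closed , Q.0-closed , ≈ᴹ-sym (+ᴹ-identityˡ 0ᴹ)
    ; +-closed  = λ (a , b , p , q , x≈) (a′ , b′ , p′ , q′ , x′≈) →
        a +ᴹ a′ , b +ᴹ b′ , P.+-closed p p′ , Q.+-closed q q′ ,
        ≈ᴹ-trans (+ᴹ-cong x≈ x′≈) (interchange a b a′ b′)
    ; *ₗ-closed = λ c (a , b , p , q , x≈) →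
        c *ₗ a , c *ₗ b , P.*ₗ-closed c p , Q.*ₗ-closed c q ,
        ≈ᴹ-trans (*ₗ-congˡ x≈) (*ₗ-distribˡ c a b)
    }
    where
    open LeftModule M
    open ModuleProperties M
    module P = Submodule P
    module Q = Submodule Q

  module _ {m ℓm n ℓn : Level} {M : LeftModule R m ℓm} {N : LeftModule R n ℓn}
           (f : Hom M N) where
    private
      module M = LeftModule M
      module N = LeftModule N
    open Hom f

    preimage : ∀ {s : Level} → Submodule N s → Submodule M s
    preimage P = record
      { Member    = λ x → ⟦ x ⟧ ∈ P
      ; resp      = λ e → P.resp (⟦⟧-cong e)
      ; 0-closed  = P.≈0⇒Member 0ᴹ-homo
      ; +-closed  = λ p q → P.resp (N.≈ᴹ-sym (+ᴹ-homo _ _)) (P.+-closed p q)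
      ; *ₗ-closed = λ a p → P.resp (N.≈ᴹ-sym (*ₗ-homo a _)) (P.*ₗ-closed a p)
      }
      where
      module P = Submodule P

    kernel : Submodule M ℓn
    kernel = preimage (zeroˢ N)

    imageOf : ∀ {s : Level} → Submodule M s → Submodule N (m ⊔ ℓn ⊔ s)
    imageOf P = record
      { Member    = λ y → ∃ λ x → x ∈ P × ⟦ x ⟧ N.≈ᴹ y
      ; resp      = λ e (x , p , q) → x , p , N.≈ᴹ-trans q e
      ; 0-closed  = M.0ᴹ , P.0-closed , 0ᴹ-homo
      ; +-closed  = λ (x , p , q) (x′ , p′ , q′) →
          x M.+ᴹ x′ , P.+-closed p p′ , N.≈ᴹ-trans (+ᴹ-homo x x′) (N.+ᴹ-cong q q′)
      ; *ₗ-closed = λ a (x , p , q) →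
          a M.*ₗ x , P.*ₗ-closed a p , N.≈ᴹ-trans (*ₗ-homo a x) (N.*ₗ-congˡ q)
      }
      where
      module P = Submodule P

    image : Submodule N (m ⊔ ℓn)
    image = imageOf (fullˢ {s = ℓn} M)

  infixl 5 _/_
  -- The subquotient P / (P ∩ Q): Q is not required to be contained in P.
  _/_ : ∀ {m ℓm s s′ : Level} {M : LeftModule R m ℓm} →
        Submodule M s → Submodule M s′ → LeftModule R (m ⊔ s) s′
  _/_ {M = M} P Q = record
    { Carrierᴹ     = Σ Carrierᴹ P.Member
    ; _≈ᴹ_         = λ (x , _) (y , _) → (x -ᴹ y) ∈ Q
    ; _+ᴹ_         = λ (x , p) (y , q) → x +ᴹ y , P.+-closed p q
    ; _*ₗ_         = λ a (x , p) → a *ₗ x , P.*ₗ-closed a p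
    ; 0ᴹ           = 0ᴹ , P.0-closed
    ; -ᴹ_          = λ (x , p) → -ᴹ x , P.neg-closed p
    ; isLeftModule = record
      { isLeftSemimodule = record
        { +ᴹ-isCommutativeMonoid = record
          { isMonoid = record
            { isSemigroup = record
              { isMagma = record
                { isEquivalence = record
                  { refl  = Q.≈⇒Member ≈ᴹ-refl
                  ; sym   = λ q → Q.resp (-ᴹ-anti _ _) (Q.neg-closed q)
                  ; trans = λ q q′ → Q.resp (-ᴹ-telescope _ _ _) (Q.+-closed q q′)
                  }
                ; ∙-cong = λ q q′ → Q.resp (≈ᴹ-sym (-ᴹ-interchange _ _ _ _)) (Q.+-closed q q′)
                }
              ; assoc = λ _ _ _ → Q.≈⇒Member (+ᴹ-assoc _ _ _)
              }
            ; identity = (λ _ → Q.≈⇒Member (+ᴹ-identityˡ _)) , (λ _ → Q.≈⇒Member (+ᴹ-identityʳ _))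
            }
          ; comm = λ _ _ → Q.≈⇒Member (+ᴹ-comm _ _)
          }
        ; isPreleftSemimodule = record
          { *ₗ-cong      = λ {a} {b} {(x , _)} {(y , _)} a≈b q →
              Q.resp (≈ᴹ-trans (*ₗ-distribˡ a x _)
                       (+ᴹ-congˡ (≈ᴹ-trans (*ₗ-neg a y) (-ᴹ‿cong (*ₗ-congʳ a≈b)))))
                     (Q.*ₗ-closed a q)
          ; *ₗ-zeroˡ     = λ _ → Q.≈⇒Member (*ₗ-zeroˡ _)
          ; *ₗ-distribʳ  = λ _ _ _ → Q.≈⇒Member (*ₗ-distribʳ _ _ _)
          ; *ₗ-identityˡ = λ _ → Q.≈⇒Member (*ₗ-identityˡ _)
          ; *ₗ-assoc     = λ _ _ _ → Q.≈⇒Member (*ₗ-assoc _ _ _)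
          ; *ₗ-zeroʳ     = λ _ → Q.≈⇒Member (*ₗ-zeroʳ _)
          ; *ₗ-distribˡ  = λ _ _ _ → Q.≈⇒Member (*ₗ-distribˡ _ _ _)
          }
        }
      ; -ᴹ‿cong    = λ q → Q.resp (≈ᴹ-sym (-ᴹ-+ᴹ-comm _ _)) (Q.neg-closed q)
      ; -ᴹ‿inverse = (λ _ → Q.≈⇒Member (-ᴹ‿inverseˡ _)) , (λ _ → Q.≈⇒Member (-ᴹ‿inverseʳ _))
      }
    }
    where
    open LeftModule M
    open ModuleProperties M
    module P = Submodule P
    module Q = Submodule Q

  inducedHom : ∀ {m ℓm n ℓn s s′ u u′ : Level}
               {M : LeftModule R m ℓm} {N : LeftModule R n ℓn} (f : Hom M N)
               (P : Submodule M s) (Q : Submodule M s′)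
               (P′ : Submodule N u) (Q′ : Submodule N u′) →
               (∀ {x} → x ∈ P → Hom.⟦ f ⟧ x ∈ P′) → (∀ {x} → x ∈ Q → Hom.⟦ f ⟧ x ∈ Q′) →
               Hom (P / Q) (P′ / Q′)
  inducedHom f P Q P′ Q′ fP fQ = mkHom
    (λ (x , p) → ⟦ x ⟧ , fP p)
    (λ q → Q′.resp (sub-homo _ _) (fQ q))
    (λ _ _ → Q′.≈⇒Member (+ᴹ-homo _ _))
    (λ _ _ → Q′.≈⇒Member (*ₗ-homo _ _))
    where
    open Hom f
    module Q′ = Submodule Q′

  -- The differential X i → X j is indexed by a proof of i ≡ j + 1, so that both
  -- X (j + 1) → X j and X i → X (i − 1) are available without transport.
  record ChainComplex (m ℓm : Level) : Set (r ⊔ ℓr ⊔ lsuc (m ⊔ ℓm)) where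
    field
      X  : ℤ → LeftModule R m ℓm
      ∂  : ∀ {i j} → i ≡ sucℤ j → Hom (X i) (X j)
      ∂∂ : ∀ {i j k} (e : i ≡ sucℤ j) (e′ : j ≡ sucℤ k) x →
           LeftModule._≈ᴹ_ (X k) (Hom.⟦ ∂ e′ ⟧ (Hom.⟦ ∂ e ⟧ x)) (LeftModule.0ᴹ (X k))

    ∂-into : ∀ p → Hom (X (sucℤ p)) (X p)
    ∂-into p = ∂ ≡.refl

    ∂-from : ∀ p → Hom (X p) (X (predℤ p))
    ∂-from p = ∂ (≡.sym (ℤₚ.suc-pred p))

    homology : ℤ → LeftModule R (m ⊔ ℓm) (m ⊔ ℓm)
    homology p = kernel (∂-from p) / image (∂-into p)

  record FilteredComplex (m ℓm s : Level) : Set (r ⊔ ℓr ⊔ lsuc (m ⊔ ℓm ⊔ s)) where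
    field
      complex : ChainComplex m ℓm
    open ChainComplex complex public
    field
      F          : ℤ → ∀ p → Submodule (X p) s
      decreasing : ∀ {t u} p {x} → t Int.≤ u → x ∈ F u p → x ∈ F t p
      ∂-closed   : ∀ t {i j} (e : i ≡ sucℤ j) {x} → x ∈ F t i → Hom.⟦ ∂ e ⟧ x ∈ F t j

  module SpectralSequence {m ℓm s : Level} (C : FilteredComplex m ℓm s) where
    open FilteredComplex C
    open Int using (_+_; _-_)

    E₀ : ℤ → ChainComplex (m ⊔ s) s
    E₀ t = record
      { X  = λ p → F t p / F (t + 1ℤ) p
      ; ∂  = λ {i} {j} e → inducedHom (∂ e) (F t i) (F (t + 1ℤ) i) (F t j) (F (t + 1ℤ) j)
                             (∂-closed t e) (∂-closed (t + 1ℤ) e)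
      ; ∂∂ = λ {k = k} e e′ (x , _) →
          let open LeftModule (X k)
              open ModuleProperties (X k)
          in Submodule.≈0⇒Member (F (t + 1ℤ) k) (≈ᴹ-trans (x-0≈x _) (∂∂ e e′ x))
      }

    -- The complementary index q makes t + q the chain degree.
    E₁ : ℤ → ℤ → LeftModule R (m ⊔ s) (m ⊔ s)
    E₁ t q = ChainComplex.homology (E₀ t) (t + q)

    -- Z s t p = { x ∈ Fᵗ X_p : ∂ x ∈ Fᵗ⁺ˢ X_{p-1} }
    Z : ℤ → ℤ → ∀ p → Submodule (X p) s
    Z s t p = F t p ∩ preimage (∂-from p) (F (t + s) (predℤ p))

    B : ℤ → ℤ → ∀ p → Submodule (X p) (m ⊔ ℓm ⊔ s)
    B r t p = Z (r - 1ℤ) (t + 1ℤ) p ⊕ imageOf (∂-into p) (Z (r - 1ℤ) (t - r + 1ℤ) (sucℤ p))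

    -- The standard description of the pages of the spectral sequence of a filtered
    -- complex, here with the chain degree p in place of the complementary degree q:
    -- page r t (t + q) is E_r^{t,q}.
    page : ℕ → ℤ → ℤ → LeftModule R (m ⊔ s) (m ⊔ ℓm ⊔ s)
    page r t p = Z (+ r) t p / B (+ r) t p

    private
      ∂-from∈image : ∀ {i j u} (P : ∀ p → Submodule (X p) u) (e : i ≡ sucℤ j) {x} →
                     x ∈ P i → Hom.⟦ ∂ e ⟧ x ∈ imageOf (∂-into j) (P (sucℤ j))
      ∂-from∈image {j = j} P ≡.refl {x} x∈ = x , x∈ , LeftModule.≈ᴹ-refl (X j)

      shift : ∀ t r → t + 1ℤ ≡ (t + r) - r + 1ℤ
      shift t r = ≡.cong (λ u → u + 1ℤ) (≡.sym (≡.trans (ℤₚ.+-assoc t r _)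
        (≡.trans (≡.cong (λ u → t + u) (ℤₚ.+-inverseʳ r)) (ℤₚ.+-identityʳ t))))

    differential : ∀ r t p → Hom (page r t p) (page r (t + + r) (predℤ p))
    differential r t p = inducedHom (∂-from p) (Z (+ r) t p) (B (+ r) t p) Z′ (B (+ r) (t + + r) p′)
      (λ (_ , x∈) → x∈ , Submodule.≈0⇒Member (F (t + + r + + r) (predℤ p′)) (∂∂ _ _ _))
      (λ (a , b , a∈ , (y , _ , ∂y≈b) , x≈a+b) →
        0ᴹ , f a , Submodule.0-closed (Z (+ r - 1ℤ) (t + + r + 1ℤ) p′) ,
        ∂-from∈image (Z (+ r - 1ℤ) ((t + + r) - + r + 1ℤ)) (≡.sym (ℤₚ.suc-pred p))
          (≡.subst (λ u → a ∈ Z (+ r - 1ℤ) u p) (shift t (+ r)) a∈) ,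
        (begin
          f _           ≈⟨ ⟦⟧-cong x≈a+b ⟩
          f _           ≈⟨ +ᴹ-homo a b ⟩
          f a +ᴹ f b    ≈⟨ +ᴹ-comm _ _ ⟩
          f b +ᴹ f a    ≈⟨ +ᴹ-congʳ (⟦⟧-cong ∂y≈b) ⟨
          _             ≈⟨ +ᴹ-congʳ (∂∂ _ _ y) ⟩
          0ᴹ +ᴹ f a     ∎))
      where
      p′ : ℤ
      p′ = predℤ p
      Z′ : Submodule (X p′) s
      Z′ = Z (+ r) (t + + r) p′
      open Hom (∂-from p) renaming (⟦_⟧ to f)
      open LeftModule (X p′)
      open SetoidReasoning ≈ᴹ-setoid

    CollapsesAt : ℕ → Set (m ⊔ ℓm ⊔ s)
    CollapsesAt r₀ = ∀ r → r₀ ℕ.≤ r → ∀ t p → IsZeroHom (differential r t p)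

    page₁≅E₁ : ∀ t q → page 1 t (t + q) ≅ E₁ t q
    page₁≅E₁ t q = to , record
      { isLeftModuleMonomorphism = record
        { isLeftModuleHomomorphism = Hom.isLeftModuleHomomorphism toHom
        ; injective = λ {x} {x′} → to-injective (proj₁ x) (proj₁ x′)
                        (proj₁ (proj₂ x)) (proj₁ (proj₂ x′)) (proj₂ (proj₂ x)) (proj₂ (proj₂ x′))
        }
      ; surjective = λ ((x , x∈) , ∂x∈) →
          (x , x∈ , F⁺′.resp (x-0≈x′ _) ∂x∈) , λ {z} z≈x →
          to-cong {z} {x , x∈ , F⁺′.resp (x-0≈x′ _) ∂x∈} z≈x
      }
      where
      p : ℤ
      p = t + q
      module E₁ = LeftModule (E₁ t q)
      module P = LeftModule (page 1 t p)
      module F⁻  = Submodule (F t (sucℤ p))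
      module F⁺  = Submodule (F (t + 1ℤ) p)
      module F⁺′ = Submodule (F (t + 1ℤ) (predℤ p))
      open LeftModule (X p)
      open ModuleProperties (X p)
      open ModuleProperties (X (predℤ p)) using () renaming (x-0≈x to x-0≈x′)
      open SetoidReasoning ≈ᴹ-setoid
      open Hom (∂-into p) using (⟦_⟧; 0ᴹ-homo)

      to : P.Carrierᴹ → E₁.Carrierᴹ
      to (x , x∈ , ∂x∈) =
        (x , x∈) , F⁺′.resp (LeftModule.≈ᴹ-sym (X (predℤ p)) (x-0≈x′ _)) ∂x∈

      t≡ : t - 1ℤ + 1ℤ ≡ t
      t≡ = ≡.trans (ℤₚ.+-assoc t _ _) (ℤₚ.+-identityʳ t)

      rearrange : ∀ {d a b} → d ≈ᴹ a +ᴹ b → b -ᴹ d ≈ᴹ -ᴹ a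
      rearrange {d} {a} {b} d≈ = begin
        b -ᴹ d                  ≈⟨ -ᴹ-cong₂ (≈ᴹ-sym (+ᴹ-identityˡ b)) d≈ ⟩
        (0ᴹ +ᴹ b) -ᴹ (a +ᴹ b)   ≈⟨ -ᴹ-interchange 0ᴹ b a b ⟩
        (0ᴹ -ᴹ a) +ᴹ (b -ᴹ b)   ≈⟨ +ᴹ-cong (+ᴹ-identityˡ _) (-ᴹ‿inverseʳ b) ⟩
        (-ᴹ a) +ᴹ 0ᴹ            ≈⟨ +ᴹ-identityʳ _ ⟩
        -ᴹ a                    ∎

      to-cong : ∀ {x x′} → x P.≈ᴹ x′ → to x E₁.≈ᴹ to x′
      to-cong (a , b , (a∈ , _) , (y , (y∈ , _) , ∂y≈b) , x-x′≈) =
        (y , ≡.subst (λ u → y ∈ F u (sucℤ p)) t≡ y∈) , tt ,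
        F⁺.resp (≈ᴹ-sym (≈ᴹ-trans (+ᴹ-congʳ ∂y≈b) (rearrange x-x′≈))) (F⁺.neg-closed a∈)

      ≈⇒≈E₁ : ∀ {x x′} → proj₁ (proj₁ x) ≈ᴹ proj₁ (proj₁ x′) → x E₁.≈ᴹ x′
      ≈⇒≈E₁ x≈x′ = (_ , F⁻.0-closed) , tt ,
        F⁺.≈0⇒Member (≈ᴹ-trans (-ᴹ-cong₂ 0ᴹ-homo (≈⇒-≈0 x≈x′)) (x-0≈x 0ᴹ))

      toHom : Hom (page 1 t p) (E₁ t q)
      toHom = mkHom to (λ {x} {x′} → to-cong {x} {x′})
        (λ x x′ → ≈⇒≈E₁ {to (x P.+ᴹ x′)} {to x E₁.+ᴹ to x′} ≈ᴹ-refl)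
        (λ a x → ≈⇒≈E₁ {to (a P.*ₗ x)} {a E₁.*ₗ to x} ≈ᴹ-refl)

      to-injective : ∀ x x′ (x∈ : x ∈ F t p) (x′∈ : x′ ∈ F t p) ∂x∈ ∂x′∈ →
                     to (x , x∈ , ∂x∈) E₁.≈ᴹ to (x′ , x′∈ , ∂x′∈) →
                     (x , x∈ , ∂x∈) P.≈ᴹ (x′ , x′∈ , ∂x′∈)
      to-injective x x′ x∈ x′∈ ∂x∈ ∂x′∈ ((y , y∈) , _ , ∂y-[x-x′]∈) =
        a , ⟦ y ⟧ , (a∈ , ∂a∈) ,
        (y , (≡.subst (λ u → y ∈ F u (sucℤ p)) (≡.sym t≡) y∈ ,
              ≡.subst (λ u → ∂y ∈ F u _) (≡.sym (≡.trans (ℤₚ.+-identityʳ _) t≡)) ∂y∈) , ≈ᴹ-refl) ,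
        ≈ᴹ-sym (≈ᴹ-trans (+ᴹ-assoc _ _ _)
          (≈ᴹ-trans (+ᴹ-congˡ (-ᴹ‿inverseˡ _)) (+ᴹ-identityʳ _)))
        where
        a = (x -ᴹ x′) -ᴹ ⟦ y ⟧
        a∈ : a ∈ F (t + 1ℤ) p
        a∈ = F⁺.resp (-ᴹ-anti _ _) (F⁺.neg-closed ∂y-[x-x′]∈)
        ∂y = Hom.⟦ ∂-from (sucℤ p) ⟧ y
        ∂y∈ : ∂y ∈ F t (predℤ (sucℤ p))
        ∂y∈ = ∂-closed t _ y∈
        ∂a∈ : Hom.⟦ ∂-from p ⟧ a ∈ F (t + 1ℤ + 0ℤ) (predℤ p)
        ∂a∈ = ≡.subst (λ u → Hom.⟦ ∂-from p ⟧ a ∈ F u (predℤ p)) (≡.sym (ℤₚ.+-identityʳ _))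
                (∂-closed (t + 1ℤ) _ a∈)

module Diagonal {c ℓ : Level} (A : CommutativeRing c ℓ) {k : ℕ} (s : Vec ℕ (suc k)) where

  open CommutativeRing A hiding (zero)
  open Modules ring
  open Exp semiring using (_^_)
  open Sum semiring using (sum; sum-cong-≋; sum-syntax; ∑-distrib-+; *-distribˡ-sum)
  open SetoidReasoning setoid

  n : ℕ
  n = foldr₁ _⊓_ s ∸ 1

  -- M a p is M_a(p) = n_a − 1 − n + p, with n_a itself in place of the index a; the
  -- summand p comes first so that M a (suc p) reduces to suc (M a p).
  M : ℕ → ℕ → ℕ
  M a p = p ℕ.+ (a ∸ 1 ∸ n)

  -- Tuples are first-order data rather than dependent functions, so that every function
  -- I p → A respects equality of indices without function extensionality.
  I : ℕ → Set
  I p = All (λ a → Fin (suc (M a p))) s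

  -- Δ p i is Δ_i^{p+1} : I_p → I_{p+1}.
  Δ : ∀ p → Fin (suc (suc p)) → I p → I (suc p)
  Δ p i = All.map (λ {a} → punchIn (i ↑ˡ (a ∸ 1 ∸ n)))

  depth : ∀ {p} → I p → ℕ
  depth m = foldr₁ _⊓_ (All.reduce toℕ m)

  Tensor : ℕ → LeftModule ring c ℓ
  Tensor p = record
    { Carrierᴹ     = I p → Carrier
    ; _≈ᴹ_         = λ T U → ∀ m → T m ≈ U m
    ; _+ᴹ_         = λ T U m → T m + U m
    ; _*ₗ_         = λ a T m → a * T m
    ; 0ᴹ           = λ _ → 0#
    ; -ᴹ_          = λ T m → - T m
    ; isLeftModule = record
      { isLeftSemimodule = record
        { +ᴹ-isCommutativeMonoid = Pointwise.isCommutativeMonoid (I p) +-isCommutativeMonoid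
        ; isPreleftSemimodule    = record
          { *ₗ-cong      = λ a≈b T≈U m → *-cong a≈b (T≈U m)
          ; *ₗ-zeroˡ     = λ _ _ → zeroˡ _
          ; *ₗ-distribʳ  = λ _ _ _ _ → distribʳ _ _ _
          ; *ₗ-identityˡ = λ _ _ → *-identityˡ _
          ; *ₗ-assoc     = λ _ _ _ _ → *-assoc _ _ _
          ; *ₗ-zeroʳ     = λ _ _ → zeroʳ _
          ; *ₗ-distribˡ  = λ _ _ _ _ → distribˡ _ _ _
          }
        }
      ; -ᴹ‿cong    = λ T≈U m → -‿cong (T≈U m)
      ; -ᴹ‿inverse = (λ _ _ → -‿inverseˡ _) , (λ _ _ → -‿inverseʳ _)
      }
    }

  -- face p i is d_i^{p+1} : X_{p+1} → X_p.
  face : ∀ p → Fin (suc (suc p)) → (I (suc p) → Carrier) → (I p → Carrier)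
  face p i T = T ∘ Δ p i

  boundary : ∀ p → (I (suc p) → Carrier) → (I p → Carrier)
  boundary p T m = ∑[ i < suc (suc p) ] ((- 1#) ^ toℕ i * face p i T m)

  X : ℤ → LeftModule ring c ℓ
  X (+ p)    = Tensor p
  X -[1+ _ ] = Zero.leftModule

  private
    *-swap : ∀ a b x → a * (b * x) ≈ b * (a * x)
    *-swap a b x = trans (sym (*-assoc a b x)) (trans (*-congʳ (*-comm a b)) (*-assoc b a x))

    alt : ∀ {n} → (Fin n → Carrier) → Carrier
    alt f = sum (λ i → (- 1#) ^ toℕ i * f i)

    alt-cong : ∀ {n} {f g : Fin n → Carrier} → (∀ i → f i ≈ g i) → alt f ≈ alt g
    alt-cong {n} f≈g = sum-cong-≋ {n} (λ i → *-congˡ (f≈g i))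

    alt-+ : ∀ {n} (f g : Fin n → Carrier) → alt (λ i → f i + g i) ≈ alt f + alt g
    alt-+ {n} f g = trans (sum-cong-≋ {n} (λ i → distribˡ _ (f i) (g i))) (∑-distrib-+ {n} _ _)

    alt-* : ∀ {n} a (f : Fin n → Carrier) → alt (λ i → a * f i) ≈ a * alt f
    alt-* {n} a f = trans (sum-cong-≋ {n} (λ i → *-swap _ a (f i))) (sym (*-distribˡ-sum {n} a _))

    alt-neg : ∀ {n} (f : Fin n → Carrier) → alt (λ i → - f i) ≈ - alt f
    alt-neg {n} f = begin
      alt (λ i → - f i)       ≈⟨ alt-cong {n} (λ i → sym (-1*x≈-x (f i))) ⟩
      alt (λ i → - 1# * f i)  ≈⟨ alt-* {n} (- 1#) f ⟩
      - 1# * alt f            ≈⟨ -1*x≈-x _ ⟩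
      - alt f                 ∎
      where
      open RingProperties ring using (-1*x≈-x)

    alt-suc : ∀ {n} (f : Fin (suc n) → Carrier) → alt f ≈ f zero - alt (f ∘ suc)
    alt-suc {n} f = +-cong (*-identityˡ _) (begin
      sum (λ i → (- 1# * (- 1#) ^ toℕ i) * f (suc i))  ≈⟨ sum-cong-≋ {n} (λ i → *-assoc _ _ _) ⟩
      sum (λ i → - 1# * ((- 1#) ^ toℕ i * f (suc i)))  ≈⟨ *-distribˡ-sum {n} (- 1#) _ ⟨
      - 1# * alt (f ∘ suc)                             ≈⟨ -1*x≈-x _ ⟩
      - alt (f ∘ suc)                                  ∎)
      where
      open RingProperties ring using (-1*x≈-x)

    alt-0 : ∀ {n} {f : Fin n → Carrier} → (∀ i → f i ≈ 0#) → alt f ≈ 0#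
    alt-0 {n} f≈0 = trans (alt-cong {n} (λ i → trans (f≈0 i) (sym (zeroˡ 0#))))
                      (trans (alt-* {n} 0# (λ _ → 0#)) (zeroˡ _))

  boundaryHom : ∀ p → Hom (Tensor (suc p)) (Tensor p)
  boundaryHom p = mkHom (boundary p)
    (λ T≈U m → alt-cong (λ i → T≈U (Δ p i m)))
    (λ T U m → alt-+ (λ i → face p i T m) (λ i → face p i U m))
    (λ a T m → alt-* a (λ i → face p i T m))

  ∂ : ∀ {i j} → i ≡ sucℤ j → Hom (X i) (X j)
  ∂ {j = + p}           ≡.refl = boundaryHom p
  ∂ {j = -[1+ zero ]}   ≡.refl = mkHom (λ _ → tt) (λ _ → tt) (λ _ _ → tt) (λ _ _ → tt)
  ∂ {j = -[1+ suc _ ]}  ≡.refl = mkHom (λ _ → tt) (λ _ → tt) (λ _ _ → tt) (λ _ _ → tt)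

  private
    x-[x-y]≈y : ∀ x y → x - (x - y) ≈ y
    x-[x-y]≈y x y = begin
      x - (x - y)        ≈⟨ +-congˡ (⁻¹-anti-homo‿- x y) ⟩
      x + (y - x)        ≈⟨ +-comm x _ ⟩
      (y - x) + x        ≈⟨ +-assoc y _ x ⟩
      y + (- x + x)      ≈⟨ +-congˡ (-‿inverseˡ x) ⟩
      y + 0#             ≈⟨ +-identityʳ y ⟩
      y                  ∎
      where
      open AbelianGroupProperties +-abelianGroup using (⁻¹-anti-homo‿-)

    -- f j i plays the role of d_i d_j T at a fixed index.
    alt-alt : ∀ n (f : Fin (suc n) → Fin n → Carrier) →
              (∀ i j → toℕ i ℕ.≤ toℕ j → f (suc j) i ≈ f (inject₁ i) j) →
              alt (λ i → alt (λ j → f j i)) ≈ 0#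
    alt-alt zero    f f-sym = refl
    alt-alt (suc n) f f-sym = begin
      alt (λ i → alt (λ j → f j i))
        ≈⟨ alt-suc (λ i → alt (λ j → f j i)) ⟩
      alt (λ j → f j zero) - alt (λ i → alt (λ j → f j (suc i)))
        ≈⟨ +-cong first (-‿cong rest) ⟩
      b - (b - alt (λ i → alt (λ j → f (suc j) (suc i))))
        ≈⟨ x-[x-y]≈y b _ ⟩
      alt (λ i → alt (λ j → f (suc j) (suc i)))
        ≈⟨ alt-alt n (λ j i → f (suc j) (suc i)) (λ i j i≤j → f-sym (suc i) (suc j) (ℕ.s≤s i≤j)) ⟩
      0# ∎
      where
      b = alt (λ i → f zero (suc i))
      first : alt (λ j → f j zero) ≈ b
      first = begin
        alt (λ j → f j zero)                        ≈⟨ alt-suc (λ j → f j zero) ⟩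
        f zero zero - alt (λ j → f (suc j) zero)    ≈⟨ +-congˡ (-‿cong (alt-cong (λ j → f-sym zero j ℕ.z≤n))) ⟩
        f zero zero - alt (λ j → f zero j)          ≈⟨ +-congˡ (-‿cong (alt-suc (λ j → f zero j))) ⟩
        f zero zero - (f zero zero - b)             ≈⟨ x-[x-y]≈y _ b ⟩
        b                                           ∎
      rest : alt (λ i → alt (λ j → f j (suc i))) ≈ b - alt (λ i → alt (λ j → f (suc j) (suc i)))
      rest = begin
        alt (λ i → alt (λ j → f j (suc i)))
          ≈⟨ alt-cong (λ i → alt-suc (λ j → f j (suc i))) ⟩
        alt (λ i → f zero (suc i) - alt (λ j → f (suc j) (suc i)))
          ≈⟨ alt-+ (λ i → f zero (suc i)) (λ i → - alt (λ j → f (suc j) (suc i))) ⟩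
        b + alt (λ i → - alt (λ j → f (suc j) (suc i)))
          ≈⟨ +-congˡ (alt-neg (λ i → alt (λ j → f (suc j) (suc i)))) ⟩
        b - alt (λ i → alt (λ j → f (suc j) (suc i))) ∎

    punchIn-punchIn : ∀ p e (i j : Fin (suc p)) → toℕ i ℕ.≤ toℕ j → (x : Fin (p ℕ.+ e)) →
                      punchIn (suc j ↑ˡ e) (punchIn (i ↑ˡ e) x) ≡
                      punchIn (inject₁ i ↑ˡ e) (punchIn (j ↑ˡ e) x)
    punchIn-punchIn p       e zero    j       i≤j       x       = ≡.refl
    punchIn-punchIn (suc p) e (suc i) (suc j) (ℕ.s≤s i≤j) zero    = ≡.refl
    punchIn-punchIn (suc p) e (suc i) (suc j) (ℕ.s≤s i≤j) (suc x) =
      ≡.cong suc (punchIn-punchIn p e i j i≤j x)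

    map-map : ∀ {P Q R Q′ : ℕ → Set} {l} {v : Vec ℕ l}
              (f : ∀ {a} → P a → Q a) (g : ∀ {a} → Q a → R a)
              (f′ : ∀ {a} → P a → Q′ a) (g′ : ∀ {a} → Q′ a → R a) →
              (∀ {a} (x : P a) → g (f x) ≡ g′ (f′ x)) →
              (m : All P v) → All.map g (All.map f m) ≡ All.map g′ (All.map f′ m)
    map-map f g f′ g′ eq []      = ≡.refl
    map-map f g f′ g′ eq (x ∷ m) = ≡.cong₂ _∷_ (eq x) (map-map f g f′ g′ eq m)

  ΔΔ : ∀ p (i j : Fin (suc (suc p))) → toℕ i ℕ.≤ toℕ j → (m : I p) →
       Δ (suc p) (suc j) (Δ p i m) ≡ Δ (suc p) (inject₁ i) (Δ p j m)
  ΔΔ p i j i≤j = map-map _ _ _ _ (λ {a} → punchIn-punchIn (suc p) (a ∸ 1 ∸ n) i j i≤j)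

  boundary² : ∀ p T m → boundary p (boundary (suc p) T) m ≈ 0#
  boundary² p T m = alt-alt (suc (suc p)) (λ j i → T (Δ (suc p) j (Δ p i m)))
    (λ i j i≤j → reflexive (≡.cong T (ΔΔ p i j i≤j m)))

  chainComplex : ChainComplex c ℓ
  chainComplex = record { X = X ; ∂ = λ {i} {j} → ∂ {i} {j} ; ∂∂ = λ {i} {j} {k} → ∂∂ {i} {j} {k} }
    where
    ∂∂ : ∀ {i j k} (e : i ≡ sucℤ j) (e′ : j ≡ sucℤ k) x →
         LeftModule._≈ᴹ_ (X k) (Hom.⟦ ∂ {j} {k} e′ ⟧ (Hom.⟦ ∂ {i} {j} e ⟧ x)) (LeftModule.0ᴹ (X k))
    ∂∂ {k = + p}           ≡.refl ≡.refl T m = boundary² p T m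
    ∂∂ {k = -[1+ _ ]}      _      _      _ = tt

  F : ℤ → ∀ p → Submodule (X p) ℓ
  F t (+ p) = record
    { Member    = λ T → ∀ m → ¬ (+ depth m Int.≥ t Int.+ + p) → T m ≈ 0#
    ; resp      = λ T≈U T∈ m h → trans (sym (T≈U m)) (T∈ m h)
    ; 0-closed  = λ _ _ → refl
    ; +-closed  = λ T∈ U∈ m h → trans (+-cong (T∈ m h) (U∈ m h)) (+-identityˡ 0#)
    ; *ₗ-closed = λ a T∈ m h → trans (*-congˡ (T∈ m h)) (zeroʳ a)
    }
  F t -[1+ _ ] = fullˢ Zero.leftModule

  private
    punchIn≤suc : ∀ {n} (i : Fin (suc n)) x → toℕ (punchIn i x) ℕ.≤ suc (toℕ x)
    punchIn≤suc zero    x       = ℕₚ.≤-refl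
    punchIn≤suc (suc i) zero    = ℕ.z≤n
    punchIn≤suc (suc i) (suc x) = ℕ.s≤s (punchIn≤suc i x)

    min-map≤suc : ∀ {P Q : ℕ → ℕ} {l} {v : Vec ℕ (suc l)}
                  (f : ∀ {a} → Fin (P a) → Fin (Q a)) →
                  (∀ {a} (x : Fin (P a)) → toℕ (f x) ℕ.≤ suc (toℕ x)) →
                  (m : All (Fin ∘ P) v) →
                  foldr₁ _⊓_ (All.reduce toℕ (All.map {Q = Fin ∘ Q} f m)) ℕ.≤
                  suc (foldr₁ _⊓_ (All.reduce toℕ m))
    min-map≤suc f f≤ (x ∷ [])    = f≤ x
    min-map≤suc f f≤ (x ∷ y ∷ m) = ℕₚ.⊓-mono-≤ (f≤ x) (min-map≤suc f f≤ (y ∷ m))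

  depth-Δ : ∀ p i (m : I p) → depth (Δ p i m) ℕ.≤ suc (depth m)
  depth-Δ p i m = min-map≤suc {λ a → suc (M a p)} {λ a → suc (M a (suc p))}
    (λ {a} → punchIn (i ↑ˡ (a ∸ 1 ∸ n))) (λ {a} → punchIn≤suc (i ↑ˡ (a ∸ 1 ∸ n))) m

  filteredComplex : FilteredComplex c ℓ ℓ
  filteredComplex = record
    { complex    = chainComplex
    ; F          = F
    ; decreasing = F-decreasing
    ; ∂-closed   = F-∂-closed
    }
    where
    F-decreasing : ∀ {t u} p {x} → t Int.≤ u → x ∈ F u p → x ∈ F t p
    F-decreasing (+ p)    t≤u T∈ m h = T∈ m (λ d≥ → h (ℤₚ.≤-trans (ℤₚ.+-monoˡ-≤ (+ p) t≤u) d≥))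
    F-decreasing -[1+ _ ] _   _      = tt

    F-∂-closed : ∀ t {i j} (e : i ≡ sucℤ j) {x} → x ∈ F t i → Hom.⟦ ∂ {i} {j} e ⟧ x ∈ F t j
    F-∂-closed t {j = + p} ≡.refl {T} T∈ m h =
      alt-0 (λ i → T∈ (Δ p i m) (h ∘ lower i))
      where
      lower : ∀ i → + depth (Δ p i m) Int.≥ t Int.+ + suc p → + depth m Int.≥ t Int.+ + p
      lower i d≥ = ≡.subst₂ Int._≤_
        (≡.trans (≡.cong predℤ (t+suc)) (ℤₚ.pred-suc _)) ≡.refl
        (ℤₚ.pred-mono (ℤₚ.≤-trans d≥ (Int.+≤+ (depth-Δ p i m))))
        where
        t+suc : t Int.+ + suc p ≡ sucℤ (t Int.+ + p)
        t+suc = ≡.trans (≡.sym (ℤₚ.+-assoc t 1ℤ (+ p)))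
          (≡.trans (≡.cong (λ u → u Int.+ + p) (ℤₚ.+-comm t 1ℤ)) (ℤₚ.+-assoc 1ℤ t (+ p)))
    F-∂-closed t {j = -[1+ _ ]} _ _ = tt

{-# OPTIONS --safe #-}
-- On the t-th graded piece a tensor of degree p is supported on the indices of depth
-- exactly d = t + p. At an index m of depth D, the face maps Δ_i with i ≤ D all raise every
-- coordinate of m by one, while those with i > D leave the depth at D. Hence the graded
-- differential is T ↦ (Σ_{i ≤ D} (−1)ⁱ) (T ∘ Δ_0) = [D even] (T ∘ Δ_0), and Δ_0 identifies
-- the indices of depth D with those of depth D + 1. So the graded complex is a sum of
-- isomorphisms from odd d to even d − 1.
module Submission where

open import Defs
open import Algebra.Bundles using (CommutativeRing; Ring)
open import Algebra.Module.Bundles using (LeftModule)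
import Algebra.Properties.Ring as RingProperties
import Algebra.Properties.Semiring.Exp as Exp
import Algebra.Properties.Semiring.Sum as Sum
open import Data.Fin.Base using (Fin; zero; suc; toℕ; punchIn; pinch; _↑ˡ_)
import Data.Fin.Properties as Finₚ
open import Data.Integer.Base as Int using (ℤ; +_; -[1+_]; 1ℤ) renaming (suc to sucℤ; pred to predℤ)
import Data.Integer.Properties as ℤₚ
open import Data.Nat.Base as ℕ using (ℕ; zero; suc; NonZero; _≤_; _<_; _∸_; _⊓_)
open import Data.Nat.DivMod using (_divMod_; result)
import Data.Nat.Properties as ℕₚ
open import Data.Product.Base using (_×_; _,_; ∃)
open import Data.Sum.Base using (inj₁; inj₂)
open import Data.Unit.Polymorphic.Base using (tt)
open import Data.Vec.Base using (Vec; []; _∷_; foldr₁)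
open import Data.Vec.Relation.Unary.All as All using (All; []; _∷_)
open import Function.Base using (_∘_)
open import Level using (Level; _⊔_)
open import Relation.Binary.PropositionalEquality.Core as ≡ using (_≡_)
open import Relation.Nullary.Negation.Core using (contradiction)
import Relation.Binary.Reasoning.Setoid as SetoidReasoning

-- Shifting integer filtration indices by one.

t+suc≡suc[t+] : ∀ t i → t Int.+ sucℤ i ≡ sucℤ (t Int.+ i)
t+suc≡suc[t+] t i = ≡.trans (≡.sym (ℤₚ.+-assoc t 1ℤ i))
  (≡.trans (≡.cong (Int._+ i) (ℤₚ.+-comm t 1ℤ)) (ℤₚ.+-assoc 1ℤ t i))

t+1+≡suc[t+] : ∀ t i → t Int.+ 1ℤ Int.+ i ≡ sucℤ (t Int.+ i)
t+1+≡suc[t+] t i = ≡.trans (ℤₚ.+-assoc t 1ℤ i) (t+suc≡suc[t+] t i)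

-- Filtered complexes with exact graded pieces.

module _ {r ℓr : Level} {R : Ring r ℓr} where
  open Modules R

  module _ {m ℓm s : Level} (C : FilteredComplex m ℓm s) where
    open FilteredComplex C
    open SpectralSequence C
    open Int using (_+_; _-_)

    -- Vanishing homology of `Fᵗ / Fᵗ⁺¹`, phrased with representatives in `X` so that it serves both
    -- `E₁` and all later pages.
    GradedExact : Set (m ⊔ s)
    GradedExact = ∀ t p {x} → x ∈ F t p → Hom.⟦ ∂-from p ⟧ x ∈ F (t + 1ℤ) (predℤ p) →
      ∃ λ y → y ∈ F t (sucℤ p) ×
              ModuleProperties._-ᴹ_ (X p) x (Hom.⟦ ∂-into p ⟧ y) ∈ F (t + 1ℤ) p

    E₁-zero : GradedExact → ∀ t q → IsZero (E₁ t q)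
    E₁-zero exact t q ((x , x∈) , ∂x∈) =
      let (y , y∈ , x-∂y∈) = exact t p x∈ (F⁺′.resp (x-0≈x′ _) ∂x∈)
      in (y , y∈) , tt ,
         -- Equality with zero in the quotient unfolds to `∂y - (x - 0) ∈ Fᵗ⁺¹`, the negative of
         -- what `exact` provides.
         F⁺.resp (≈ᴹ-trans (-ᴹ-anti _ _) (-ᴹ-cong₂ ≈ᴹ-refl (≈ᴹ-sym (x-0≈x x)))) (F⁺.neg-closed x-∂y∈)
      where
      p : ℤ
      p = t + q
      open LeftModule (X p)
      open ModuleProperties (X p)
      open ModuleProperties (X (predℤ p)) using () renaming (x-0≈x to x-0≈x′)
      module F⁺  = Submodule (F (t + 1ℤ) p)
      module F⁺′ = Submodule (F (t + 1ℤ) (predℤ p))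

    -- Writing `x = (x - ∂y) + ∂y` puts `x` in `B`: the first summand has the same boundary as `x`
    -- but lies one filtration step deeper, and the second is a boundary.
    page-zero : GradedExact → ∀ r t p → IsZero (page (suc r) t p)
    page-zero exact r t p (x , x∈ , ∂x∈) with exact t p x∈
      (decreasing (predℤ p) (ℤₚ.+-monoʳ-≤ t (Int.+≤+ (ℕ.s≤s ℕ.z≤n))) ∂x∈)
    ... | y , y∈ , x-∂y∈ =
          x -ᴹ ∂y , ∂y , (x-∂y∈ , ∂[x-∂y]∈) ,
          -- With `suc r` as page number, `B` asks only for `y ∈ Fᵗ⁻ʳ` and `∂y ∈ Fᵗ`; both follow
          -- from `y ∈ Fᵗ`.
          (y , (decreasing (sucℤ p) t-r≤t y∈ ,
                ≡.subst (λ u → Hom.⟦ ∂-from (sucℤ p) ⟧ y ∈ F u _) (≡.sym t-r+r≡t) (∂-closed t _ y∈)) ,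
           ≈ᴹ-refl) ,
          (begin
            x -ᴹ 0ᴹ                  ≈⟨ x-0≈x x ⟩
            x                        ≈⟨ +ᴹ-identityʳ x ⟨
            x +ᴹ 0ᴹ                  ≈⟨ +ᴹ-congˡ (-ᴹ‿inverseˡ ∂y) ⟨
            x +ᴹ ((-ᴹ ∂y) +ᴹ ∂y)     ≈⟨ +ᴹ-assoc x _ _ ⟨
            (x -ᴹ ∂y) +ᴹ ∂y          ∎)
      where
      open LeftModule (X p)
      open ModuleProperties (X p)
      open SetoidReasoning ≈ᴹ-setoid
      module X′ = LeftModule (X (predℤ p))
      module X′ₚ = ModuleProperties (X (predℤ p))
      ∂y = Hom.⟦ ∂-into p ⟧ y

      t+1+r : t + + suc r ≡ t + 1ℤ + + r
      t+1+r = ≡.sym (ℤₚ.+-assoc t 1ℤ (+ r))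

      ∂[x-∂y]∈ : Hom.⟦ ∂-from p ⟧ (x -ᴹ ∂y) ∈ F (t + 1ℤ + + r) (predℤ p)
      ∂[x-∂y]∈ = ≡.subst (λ u → Hom.⟦ ∂-from p ⟧ (x -ᴹ ∂y) ∈ F u (predℤ p)) t+1+r
        (Submodule.resp (F (t + + suc r) (predℤ p))
          (X′.≈ᴹ-sym (X′.≈ᴹ-trans (Hom.sub-homo (∂-from p) x ∂y)
            (X′.≈ᴹ-trans (X′ₚ.-ᴹ-cong₂ X′.≈ᴹ-refl (∂∂ _ _ y)) (X′ₚ.x-0≈x _))))
          ∂x∈)

      t-r+r≡t : t - + suc r + 1ℤ + + r ≡ t
      t-r+r≡t = ≡.trans (ℤₚ.+-assoc (t - + suc r) 1ℤ (+ r))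
        (≡.trans (ℤₚ.+-assoc t (Int.- + suc r) (+ suc r))
          (≡.trans (≡.cong (_+_ t) (ℤₚ.+-inverseˡ (+ suc r))) (ℤₚ.+-identityʳ t)))

      t-r≤t : t - + suc r + 1ℤ Int.≤ t
      t-r≤t = ≡.subst (t - + suc r + 1ℤ Int.≤_) t-r+r≡t (ℤₚ.i≤i+j _ (+ r))

    -- Each differential takes values in a page that is already zero.
    collapses : GradedExact → CollapsesAt 1
    collapses exact (suc r) _ t p x =
      page-zero exact r (t + + suc r) (predℤ p) (Hom.⟦ differential (suc r) t p ⟧ x)

-- Minima of tuples under coordinatewise maps.

module _ {P : ℕ → ℕ} where

  min : ∀ {l} {v : Vec ℕ (suc l)} → All (Fin ∘ P) v → ℕ
  min m = foldr₁ _⊓_ (All.reduce toℕ m)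

  -- A monotone `Q` commutes with minima, so coordinatewise bounds pass to the minimum.
  min≤ : ∀ {Q : ℕ → ℕ} {l} {v : Vec ℕ (suc l)} →
         (∀ {a b} → a ≤ b → Q a ≤ Q b) → (∀ {a} (x : Fin (P a)) → toℕ x ≤ Q a) →
         (m : All (Fin ∘ P) v) → min m ≤ Q (foldr₁ _⊓_ v)
  min≤ mono x≤ (x ∷ []) = x≤ x
  min≤ {v = a ∷ v} mono x≤ (x ∷ y ∷ m) =
    ℕₚ.≤-trans (ℕₚ.⊓-mono-≤ (x≤ x) (min≤ mono x≤ (y ∷ m)))
      (ℕₚ.≤-reflexive (≡.sym (ℕₚ.mono-≤-distrib-⊓ mono a (foldr₁ _⊓_ v))))

  module _ {Q : ℕ → ℕ} where

    map-cong-min : ∀ {D l} {v : Vec ℕ (suc l)} {f g : ∀ {a} → Fin (P a) → Fin (Q a)} →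
                   (∀ {a} (x : Fin (P a)) → D ≤ toℕ x → f x ≡ g x) →
                   (m : All (Fin ∘ P) v) → D ≤ min m → All.map {Q = Fin ∘ Q} f m ≡ All.map g m
    map-cong-min f≡g (x ∷ [])    D≤ = ≡.cong (_∷ []) (f≡g x D≤)
    map-cong-min f≡g (x ∷ y ∷ m) D≤ = ≡.cong₂ _∷_ (f≡g x (ℕₚ.m≤n⊓o⇒m≤n _ _ D≤))
      (map-cong-min f≡g (y ∷ m) (ℕₚ.m≤n⊓o⇒m≤o _ _ D≤))

module _ {P Q : ℕ → ℕ} {f : ∀ {a} → Fin (P a) → Fin (Q a)} where

  min-map-suc : ∀ {l} {v : Vec ℕ (suc l)} → (∀ {a} (x : Fin (P a)) → toℕ (f x) ≡ suc (toℕ x)) →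
                (m : All (Fin ∘ P) v) → min {Q} (All.map f m) ≡ suc (min {P} m)
  min-map-suc f≡suc (x ∷ [])    = f≡suc x
  min-map-suc f≡suc (x ∷ y ∷ m) = ≡.cong₂ _⊓_ (f≡suc x) (min-map-suc f≡suc (y ∷ m))

  -- A coordinate attaining the minimum is below `D`, so `f` does not raise it, and its image bounds
  -- the new minimum.
  min-map≤ : ∀ {D l} {v : Vec ℕ (suc l)} → (∀ {a} (x : Fin (P a)) → toℕ x < D → toℕ (f x) ≤ toℕ x) →
             (m : All (Fin ∘ P) v) → min {P} m < D → min {Q} (All.map f m) ≤ min {P} m
  min-map≤ f≤ (x ∷ [])    min< = f≤ x min<
  min-map≤ {D} f≤ (x ∷ y ∷ m) min< with ℕₚ.⊓-sel (toℕ x) (min {P} (y ∷ m))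
  ... | inj₁ eq = ℕₚ.≤-trans (ℕₚ.m⊓n≤m (toℕ (f x)) _)
        (ℕₚ.≤-trans (f≤ x (≡.subst (_< D) eq min<)) (ℕₚ.≤-reflexive (≡.sym eq)))
  ... | inj₂ eq = ℕₚ.≤-trans (ℕₚ.m⊓n≤n (toℕ (f x)) _)
        (ℕₚ.≤-trans (min-map≤ f≤ (y ∷ m) (≡.subst (_< D) eq min<)) (ℕₚ.≤-reflexive (≡.sym eq)))

punchIn-≤ : ∀ {n} (i : Fin (suc n)) x → toℕ i ≤ toℕ x → punchIn i x ≡ suc x
punchIn-≤ zero    x       _           = ≡.refl
punchIn-≤ (suc i) (suc x) (ℕ.s≤s i≤x) = ≡.cong suc (punchIn-≤ i x i≤x)

toℕ-punchIn-> : ∀ {n} (i : Fin (suc n)) x → toℕ x < toℕ i → toℕ (punchIn i x) ≤ toℕ x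
toℕ-punchIn-> (suc i) zero    _           = ℕ.z≤n
toℕ-punchIn-> (suc i) (suc x) (ℕ.s≤s x<i) = ℕ.s≤s (toℕ-punchIn-> i x x<i)

map-inverse : ∀ {P Q : ℕ → Set} {f : ∀ {a} → P a → Q a} {g : ∀ {a} → Q a → P a} →
              (∀ {a} (x : P a) → g (f x) ≡ x) →
              ∀ {l} {v : Vec ℕ l} (m : All P v) → All.map g (All.map f m) ≡ m
map-inverse gf []      = ≡.refl
map-inverse gf (x ∷ m) = ≡.cong₂ _∷_ (gf x) (map-inverse gf m)

map-inverse-min : ∀ {P Q : ℕ → ℕ} {f : ∀ {a} → Fin (P a) → Fin (Q a)}
                  {g : ∀ {a} → Fin (Q a) → Fin (P a)} {D} →
                  (∀ {a} (x : Fin (P a)) → D ≤ toℕ x → g (f x) ≡ x) →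
                  ∀ {l} {v : Vec ℕ (suc l)} (m : All (Fin ∘ P) v) → D ≤ min {P} m →
                  All.map {Q = Fin ∘ P} g (All.map {Q = Fin ∘ Q} f m) ≡ m
map-inverse-min gf (x ∷ [])    D≤ = ≡.cong (_∷ []) (gf x D≤)
map-inverse-min {Q = Q} gf (x ∷ y ∷ m) D≤ = ≡.cong₂ _∷_ (gf x (ℕₚ.m≤n⊓o⇒m≤n _ _ D≤))
  (map-inverse-min {Q = Q} gf (y ∷ m) (ℕₚ.m≤n⊓o⇒m≤o _ _ D≤))

-- Alternating sums.

module _ {c ℓ : Level} (A : CommutativeRing c ℓ) where
  open CommutativeRing A hiding (zero)
  open Sum semiring using (sum; sum-replicate-zero; sum-cong-≋)
  open RingProperties ring using (-‿distribˡ-*; -‿involutive)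
  open SetoidReasoning setoid

  -- An odd number of equal terms leaves one. Induction splits off two terms, the second of which
  -- cancels the value of the tail; `σ` is arbitrary so that the hypothesis applies to the shifted
  -- signs.
  alternating-sum : ∀ {x} e {N} → e ℕ.* 2 < N → (σ : ℕ → Carrier) → (∀ i → σ (suc i) ≈ - σ i) →
                    (f : Fin N → Carrier) → (∀ i → toℕ i ≤ e ℕ.* 2 → f i ≈ x) →
                    (∀ i → e ℕ.* 2 < toℕ i → f i ≈ 0#) →
                    sum (λ i → σ (toℕ i) * f i) ≈ σ 0 * x
  alternating-sum {x} zero {suc N} _ σ _ f f≈x f≈0 = begin
    σ 0 * f zero + sum (λ i → σ (suc (toℕ i)) * f (suc i))
      ≈⟨ +-cong (*-congˡ (f≈x zero ℕ.z≤n))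
           (sum-cong-≋ {N} (λ i → trans (*-congˡ (f≈0 (suc i) (ℕ.s≤s ℕ.z≤n))) (zeroʳ _))) ⟩
    σ 0 * x + sum {N} (λ _ → 0#)  ≈⟨ +-congˡ (sum-replicate-zero N) ⟩
    σ 0 * x + 0#                  ≈⟨ +-identityʳ _ ⟩
    σ 0 * x                       ∎
  alternating-sum {x} (suc e) {suc (suc N)} (ℕ.s≤s (ℕ.s≤s e<N)) σ σ-alt f f≈x f≈0 = begin
    σ 0 * f zero + (σ 1 * f (suc zero) + sum (λ i → σ (suc (suc (toℕ i))) * f (suc (suc i))))
      ≈⟨ +-cong (*-congˡ (f≈x zero ℕ.z≤n)) (+-cong (*-cong (σ-alt 0) (f≈x (suc zero) (ℕ.s≤s ℕ.z≤n)))
           (alternating-sum e e<N (λ i → σ (suc (suc i))) (λ i → σ-alt (suc (suc i)))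
             (λ i → f (suc (suc i)))
             (λ i i≤ → f≈x (suc (suc i)) (ℕ.s≤s (ℕ.s≤s i≤)))
             (λ i i> → f≈0 (suc (suc i)) (ℕ.s≤s (ℕ.s≤s i>))))) ⟩
    σ 0 * x + (- σ 0 * x + σ 2 * x)
      ≈⟨ +-congˡ (+-cong (sym (-‿distribˡ-* _ x)) (*-congʳ σ2≈σ0)) ⟩
    σ 0 * x + (- (σ 0 * x) + σ 0 * x)  ≈⟨ +-congˡ (-‿inverseˡ _) ⟩
    σ 0 * x + 0#                       ≈⟨ +-identityʳ _ ⟩
    σ 0 * x                            ∎
    where
    σ2≈σ0 : σ 2 ≈ σ 0
    σ2≈σ0 = trans (σ-alt 1) (trans (-‿cong (σ-alt 0)) (-‿involutive (σ 0)))

-- Faces, depth and exactness for the diagonal module.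

module _ {c ℓ : Level} (A : CommutativeRing c ℓ) {k : ℕ} (s : Vec ℕ (suc k)) where
  open CommutativeRing A hiding (zero)
  open Modules ring
  open Diagonal A s
  open FilteredComplex filteredComplex using (∂-from)
  open Exp semiring using (_^_)
  open RingProperties ring using (-1*x≈-x; -0#≈0#)

  -- The coordinate belonging to a smallest `n_a` ranges over `[p]`.
  depth≤degree : ∀ {p} (m : I p) → depth m ≤ p
  depth≤degree {p} m = ≡.subst (depth m ≤_)
    (≡.trans (≡.cong (p ℕ.+_) (ℕₚ.n∸n≡0 n)) (ℕₚ.+-identityʳ p))
    (min≤ {Q = λ a → M a p} (λ a≤b → ℕₚ.+-monoʳ-≤ p (ℕₚ.∸-monoˡ-≤ n (ℕₚ.∸-monoˡ-≤ 1 a≤b)))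
      Finₚ.toℕ≤pred[n] m)

  depth-Δ₀ : ∀ {p} (m : I p) → depth (Δ p zero m) ≡ suc (depth m)
  depth-Δ₀ {p} m = min-map-suc {P = λ a → suc (M a p)} {λ a → suc (M a (suc p))} (λ _ → ≡.refl) m

  Δ-≤depth : ∀ {p} i (m : I p) → toℕ i ≤ depth m → Δ p i m ≡ Δ p zero m
  Δ-≤depth {p} i m = map-cong-min {λ a → suc (M a p)} {λ a → suc (M a (suc p))}
    (λ x i≤x → punchIn-≤ _ x (≡.subst (_≤ toℕ x) (≡.sym (Finₚ.toℕ-↑ˡ i _)) i≤x)) m

  depth-Δ->depth : ∀ {p} i (m : I p) → depth m < toℕ i → depth (Δ p i m) ≤ depth m
  depth-Δ->depth {p} i m = min-map≤ {λ a → suc (M a p)} {λ a → suc (M a (suc p))}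
    (λ x x<i → toℕ-punchIn-> _ x (≡.subst (toℕ x <_) (≡.sym (Finₚ.toℕ-↑ˡ i _)) x<i)) m

  -- Coordinatewise truncated predecessor: a left inverse of `Δ_0`, and a two-sided one on indices
  -- of positive depth.
  lower : ∀ {p} → I (suc p) → I p
  lower = All.map (pinch zero)

  lower-Δ₀ : ∀ {p} (m : I p) → lower (Δ p zero m) ≡ m
  lower-Δ₀ = map-inverse (λ _ → ≡.refl)

  Δ₀-lower : ∀ {p} (m : I (suc p)) → 1 ≤ depth m → Δ p zero (lower m) ≡ m
  Δ₀-lower {p} = map-inverse-min {λ a → suc (M a (suc p))} {λ a → suc (M a p)} suc-pinch
    where
    suc-pinch : ∀ {q} (x : Fin (suc (suc q))) → 1 ≤ toℕ x → suc (pinch zero x) ≡ x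
    suc-pinch (suc x) _ = ≡.refl

  -- Only even D occur: for odd D the signs of the faces Δ_0, …, Δ_D cancel.
  boundary-at-depth : ∀ {p} e (T : I (suc p) → Carrier) → (∀ m → depth m ≤ e ℕ.* 2 → T m ≈ 0#) →
                      ∀ m → depth m ≡ e ℕ.* 2 → boundary p T m ≈ T (Δ p zero m)
  boundary-at-depth {p} e T T≈0 m eq = trans
    (alternating-sum A e
      (ℕ.s≤s (ℕₚ.m≤n⇒m≤1+n (≡.subst (_≤ p) eq (depth≤degree m))))
      ((- 1#) ^_) (λ _ → -1*x≈-x _) (λ i → T (Δ p i m))
      (λ i i≤ → reflexive (≡.cong T (Δ-≤depth i m (≡.subst (toℕ i ≤_) (≡.sym eq) i≤))))
      (λ i i> → T≈0 (Δ p i m) (≡.subst (depth (Δ p i m) ≤_) eq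
        (depth-Δ->depth i m (≡.subst (_< toℕ i) (≡.sym eq) i>)))))
    (*-identityˡ _)

  module _ {t : ℤ} {p d : ℕ} (eq : t Int.+ + p ≡ + d) {T : I p → Carrier} where

    F-intro : (∀ m → depth m < d → T m ≈ 0#) → T ∈ F t (+ p)
    F-intro T≈0 m h = T≈0 m
      (ℕₚ.≰⇒> (λ d≤ → h (≡.subst (Int._≤ + depth m) (≡.sym eq) (Int.+≤+ d≤))))

    F-elim : T ∈ F t (+ p) → ∀ m → depth m < d → T m ≈ 0#
    F-elim T∈ m m<d = T∈ m
      (λ h → ℕₚ.<⇒≱ m<d (ℤₚ.drop‿+≤+ (≡.subst (Int._≤ + depth m) eq h)))

  -- Here `t + 1 + p ≤ 0`, so every index meets the depth condition and the graded piece is zero.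
  F-negative : ∀ {t p j} → t Int.+ + p ≡ -[1+ j ] → ∀ T → T ∈ F (t Int.+ 1ℤ) (+ p)
  F-negative {t} {p} {j} eq T m h = contradiction
    (ℤₚ.≤-trans (≡.subst (Int._≤ + 0) (≡.sym (≡.trans (t+1+≡suc[t+] t (+ p)) (≡.cong sucℤ eq)))
      (ℤₚ.i<j⇒suc[i]≤j {i = -[1+ j ]} Int.-<+)) (Int.+≤+ ℕ.z≤n)) h

  -- Generalising over the degree equation inside `∂-from` makes it possible to match on `refl`.
  ∂-from-suc : ∀ p T → Hom.⟦ ∂-from (+ suc p) ⟧ T ≡ boundary p T
  ∂-from-suc p T = lemma (≡.sym (ℤₚ.suc-pred (+ suc p)))
    where
    lemma : (e : + suc p ≡ sucℤ (+ p)) → Hom.⟦ ∂ {+ suc p} {+ p} e ⟧ T ≡ boundary p T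
    lemma ≡.refl = ≡.refl

  lift-from : ℕ → Carrier → Carrier
  -- An index of depth 0 is outside the image of `Δ_0`.
  lift-from zero    _ = 0#
  lift-from (suc _) x = x

  -- Extension by zero along `Δ_0`, whose image is the set of indices of positive depth.
  raise : ∀ {p} → (I p → Carrier) → I (suc p) → Carrier
  raise T m = lift-from (depth m) (T (lower m))

  raise-Δ₀ : ∀ {p} (T : I p → Carrier) m → raise T (Δ p zero m) ≈ T m
  raise-Δ₀ T m rewrite depth-Δ₀ m | lower-Δ₀ m = refl

  -- Lowering drops a positive depth by one, which turns `< d` into `≤ d`.
  raise-vanishes : ∀ {p d} {T : I p → Carrier} → (∀ m → depth m < d → T m ≈ 0#) →
                   ∀ m → depth m ≤ d → raise T m ≈ 0#
  raise-vanishes {d = d} T≈0 m m≤ with depth m in eq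
  ... | zero  = refl
  ... | suc j = T≈0 (lower m) (ℕₚ.≤-trans (ℕₚ.≤-reflexive
        (≡.trans (≡.sym (depth-Δ₀ (lower m)))
          (≡.trans (≡.cong depth (Δ₀-lower m (≡.subst (1 ≤_) (≡.sym eq) (ℕ.s≤s ℕ.z≤n)))) eq))) m≤)

  x-0≈x : ∀ x → x - 0# ≈ x
  x-0≈x x = trans (+-congˡ -0#≈0#) (+-identityʳ x)

  -- The preimage is `raise T`: below depth `2e` both sides vanish, and at depth `2e` its boundary
  -- is its value at `Δ_0 m`, namely `T m`.
  boundary-onto-even : ∀ {t p} e → t Int.+ + p ≡ + (e ℕ.* 2) → ∀ {T} → T ∈ F t (+ p) →
                       ∃ λ U → U ∈ F t (+ suc p) ×
                               (λ m → T m - boundary p U m) ∈ F (t Int.+ 1ℤ) (+ p)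
  boundary-onto-even {t} {p} e eq {T} T∈ = U , U∈ ,
    F-intro {t Int.+ 1ℤ} (≡.trans (t+1+≡suc[t+] t (+ p)) (≡.cong sucℤ eq)) T-∂U≈0
    where
    U : I (suc p) → Carrier
    U = raise T
    T≈0 : ∀ m → depth m < e ℕ.* 2 → T m ≈ 0#
    T≈0 = F-elim {t} eq T∈
    U∈ : U ∈ F t (+ suc p)
    U∈ = F-intro {t} (≡.trans (t+suc≡suc[t+] t (+ p)) (≡.cong sucℤ eq))
      (λ m m< → raise-vanishes T≈0 m (ℕ.s≤s⁻¹ m<))
    ∂U∈ : boundary p U ∈ F t (+ p)
    ∂U∈ = FilteredComplex.∂-closed filteredComplex t {+ suc p} {+ p} ≡.refl U∈
    T-∂U≈0 : ∀ m → depth m < suc (e ℕ.* 2) → T m - boundary p U m ≈ 0#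
    T-∂U≈0 m m< with ℕₚ.m≤n⇒m<n∨m≡n (ℕ.s≤s⁻¹ m<)
    ... | inj₁ m<e = trans (+-cong (T≈0 m m<e) (-‿cong (F-elim {t} eq ∂U∈ m m<e))) (-‿inverseʳ 0#)
    ... | inj₂ m≡e = trans (+-congˡ (-‿cong (trans
          (boundary-at-depth e U (raise-vanishes T≈0) m m≡e) (raise-Δ₀ T m)))) (-‿inverseʳ (T m))

  -- An index of depth `2e + 1` is `Δ_0` of one of depth `2e`, where `∂T` takes the value of `T` at
  -- the original index.
  boundary-injective-odd : ∀ {t p} e → t Int.+ + p ≡ + suc (e ℕ.* 2) → ∀ {T} → T ∈ F t (+ p) →
                           Hom.⟦ ∂-from (+ p) ⟧ T ∈ F (t Int.+ 1ℤ) (predℤ (+ p)) →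
                           T ∈ F (t Int.+ 1ℤ) (+ p)
  boundary-injective-odd {t} {p} e eq {T} T∈ ∂T∈ =
    F-intro {t Int.+ 1ℤ} (≡.trans (t+1+≡suc[t+] t (+ p)) (≡.cong sucℤ eq)) T≈0
    where
    T≈0′ : ∀ m → depth m < suc (e ℕ.* 2) → T m ≈ 0#
    T≈0′ = F-elim {t} eq T∈

    at-depth : ∀ p → t Int.+ + p ≡ + suc (e ℕ.* 2) → (T : I p → Carrier) →
               (∀ m → depth m < suc (e ℕ.* 2) → T m ≈ 0#) →
               Hom.⟦ ∂-from (+ p) ⟧ T ∈ F (t Int.+ 1ℤ) (predℤ (+ p)) →
               ∀ m → depth m ≡ suc (e ℕ.* 2) → T m ≈ 0#
    -- In degree 0 no index has positive depth.
    at-depth zero    eq T T≈0 ∂T∈ m m≡ = contradiction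
      (≡.subst (_≤ 0) m≡ (depth≤degree m)) (λ ())
    at-depth (suc p) eq T T≈0 ∂T∈ m m≡ =
      trans (reflexive (≡.cong T (≡.sym m≡Δ₀)))
        (trans (sym (boundary-at-depth e T (λ m m≤ → T≈0 m (ℕ.s≤s m≤)) (lower m) depth-lower))
          -- One degree down, the threshold of `Fᵗ⁺¹` is again `2e + 1`, just above the depth of
          -- `lower m`.
          (F-elim {t Int.+ 1ℤ} (≡.trans (ℤₚ.+-assoc t 1ℤ (+ p)) eq)
            (≡.subst (_∈ F (t Int.+ 1ℤ) (+ p)) (∂-from-suc p T) ∂T∈) (lower m)
            (ℕ.s≤s (ℕₚ.≤-reflexive depth-lower))))
      where
      m≡Δ₀ : Δ p zero (lower m) ≡ m
      m≡Δ₀ = Δ₀-lower m (≡.subst (1 ≤_) (≡.sym m≡) (ℕ.s≤s ℕ.z≤n))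
      depth-lower : depth (lower m) ≡ e ℕ.* 2
      depth-lower = ℕₚ.suc-injective (≡.trans (≡.sym (depth-Δ₀ (lower m))) (≡.trans (≡.cong depth m≡Δ₀) m≡))

    T≈0 : ∀ m → depth m < suc (suc (e ℕ.* 2)) → T m ≈ 0#
    T≈0 m m< with ℕₚ.m≤n⇒m<n∨m≡n (ℕ.s≤s⁻¹ m<)
    ... | inj₁ m<e = T≈0′ m m<e
    ... | inj₂ m≡e = at-depth p eq T T≈0′ ∂T∈ m m≡e

  -- For even `t + p` everything is a boundary modulo `Fᵗ⁺¹`; for odd or negative `t + p` every
  -- cycle is already in `Fᵗ⁺¹`, so zero serves as preimage.
  gradedExact : GradedExact filteredComplex
  gradedExact t -[1+ p ] _ _ = 0ᴹ , Submodule.0-closed (F t (sucℤ -[1+ p ])) , tt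
    where open LeftModule (X (sucℤ -[1+ p ]))
  gradedExact t (+ p) {T} T∈ ∂T∈ = cases _ ≡.refl
    where
    Goal : Set _
    Goal = ∃ λ U → U ∈ F t (+ suc p) × (λ m → T m - boundary p U m) ∈ F (t Int.+ 1ℤ) (+ p)

    by-zero : T ∈ F (t Int.+ 1ℤ) (+ p) → Goal
    by-zero T∈⁺ = (λ _ → 0#) , Submodule.0-closed (F t (+ suc p)) ,
      Submodule.resp (F (t Int.+ 1ℤ) (+ p))
        (λ m → sym (trans (+-congˡ (-‿cong (Hom.0ᴹ-homo (boundaryHom p) m))) (x-0≈x (T m)))) T∈⁺

    cases : ∀ i → t Int.+ + p ≡ i → Goal
    cases -[1+ _ ] eq = by-zero (F-negative {t} eq T)
    cases (+ d)    eq with d divMod 2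
    ... | result e zero       d≡ = boundary-onto-even {t} e (≡.trans eq (≡.cong +_ d≡)) T∈
    ... | result e (suc zero) d≡ = by-zero (boundary-injective-odd {t} e (≡.trans eq (≡.cong +_ d≡)) T∈ ∂T∈)

mainTheorem8 : ∀ {c ℓ} (A : CommutativeRing c ℓ) (k : ℕ) (s : Vec ℕ (suc k)) → All NonZero s →
    let open Modules (CommutativeRing.ring A)
        open SpectralSequence (Diagonal.filteredComplex A s)
    in (∀ t q → IsZero (E₁ t q)) × CollapsesAt 1
mainTheorem8 A k s _ =
  E₁-zero (Diagonal.filteredComplex A s) (gradedExact A s) ,
  collapses (Diagonal.filteredComplex A s) (gradedExact A s)
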